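{- Let $E$ be an equational theory. If $E$ is finite, i.e., for every term $t\in T(\Sigma,V)$ the set $\{s\in T(\Sigma,V)\mid s\approx_E t\}$ is finite, then $E$ is Noetherian w.r.t. the unrestricted instantiation preorder, i.e., every strictly descending chain of substitutions $\sigma_1>_E^V\sigma_2>_E^V\sigma_3>_E^V\cdots$ is finite.
   Context: $\Sigma$ is a finite signature, $V$ a countably infinite set of variables, and $T(\Sigma,V)$ the set of terms. An equational theory $E$ is a set of (implicitly universally quantified) identities between terms over $\Sigma$, and $\approx_E$ is the congruence relation on $T(\Sigma,V)$ it induces ($s\approx_E t$ iff $s\approx t$ holds in all models of $E$). All equational theories are assumed to be non-trivial: $x\approx_E y$ does not hold for distinct variables $x,y$. A substitution is a map $\sigma:V\to T(\Sigma,V)$ with finite domain $\{x\in V\mid\sigma(x)\neq x\}$, extended homomorphically to terms. The unrestricted instantiation preorder is defined by: $\sigma\leq_E^V\tau$ iff there is a substitution $\lambda$ with $\lambda(\sigma(x))\approx_E\tau(x)$ for all $x\in V$. We write $\sigma<_E^V\tau$ (equivalently $\tau>_E^V\sigma$) if $\sigma\leq_E^V\tau$ and not $\tau\leq_E^V\sigma$. -}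

module Defs where

open import Level using (0ℓ; _⊔_) renaming (suc to lsuc)
open import Data.Fin using (Fin)
open import Data.List.Membership.Propositional using (_∈_)
open import Data.Nat using (ℕ)
open import Data.Product using (∃-syntax; _×_)
open import Data.Vec using (Vec; []; _∷_)
open import Data.Vec.Relation.Binary.Pointwise.Inductive using (Pointwise)
open import Function.Bundles using (_↔_)
open import Induction.InfiniteDescent using (InfiniteDescendingSequence)
open import Relation.Binary using (Rel; Setoid)
open import Relation.Binary.PropositionalEquality using (_≢_)
open import Relation.Nullary using (¬_)
open import Relation.Unary using (Pred)

-- A predicate is finite when some list contains all its witnesses.  The list
-- may contain other elements too, so finiteness alone does not make P decidable.
Finite : ∀ {a ℓ} {A : Set a} → Pred A ℓ → Set (a ⊔ ℓ)
Finite {A = A} P = ∃[ xs ] (∀ (x : A) → P x → x ∈ xs)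

record Signature : Set₁ where
  field
    Symbol        : Set
    arity         : Symbol → ℕ
    size          : ℕ
    finitelyMany  : Symbol ↔ Fin size

open Signature public using (Symbol; arity)

data Term (Σ : Signature) (V : Set) : Set where
  var : V → Term Σ V
  fun : (f : Symbol Σ) → Vec (Term Σ V) (arity Σ f) → Term Σ V

-- Algebras are over setoids, so that quotients such as the term algebra modulo
-- a theory are available.
record Algebra (Σ : Signature) : Set₁ where
  field
    setoid : Setoid 0ℓ 0ℓ
  open Setoid setoid public using (Carrier; _≈_)
  field
    op      : (f : Symbol Σ) → Vec Carrier (arity Σ f) → Carrier
    op-cong : ∀ f {as bs : Vec Carrier (arity Σ f)} →
              Pointwise _≈_ as bs → op f as ≈ op f bs

module _ {Σ : Signature} {V : Set} where

  module _ (𝓐 : Algebra Σ) (ρ : V → Algebra.Carrier 𝓐) where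
    open Algebra 𝓐 using (Carrier; op)

    mutual
      eval : Term Σ V → Carrier
      eval (var x)    = ρ x
      eval (fun f ts) = op f (evals ts)

      evals : ∀ {n} → Vec (Term Σ V) n → Vec Carrier n
      evals []       = []
      evals (t ∷ ts) = eval t ∷ evals ts

  _⊨_≐_ : Algebra Σ → Term Σ V → Term Σ V → Set
  𝓐 ⊨ s ≐ t = ∀ ρ → eval 𝓐 ρ s ≈ eval 𝓐 ρ t
    where open Algebra 𝓐

  _IsModelOf_ : Algebra Σ → Rel (Term Σ V) 0ℓ → Set
  𝓐 IsModelOf Ax = ∀ {l r} → Ax l r → 𝓐 ⊨ l ≐ r

  -- Quantifying over algebras at level 0 loses nothing: for Ax at level 0, the
  -- quotient of the term algebra by provable equality is such an algebra.
  Entails : Rel (Term Σ V) 0ℓ → Rel (Term Σ V) (lsuc 0ℓ)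
  Entails Ax s t = ∀ (𝓐 : Algebra Σ) → 𝓐 IsModelOf Ax → 𝓐 ⊨ s ≐ t

record EquationalTheory (Σ : Signature) (V : Set) : Set₁ where
  field
    Axiom      : Rel (Term Σ V) 0ℓ
    nonTrivial : ∀ {x y : V} → x ≢ y → ¬ Entails Axiom (var x) (var y)

record Substitution (Σ : Signature) (V : Set) : Set where
  field
    image        : V → Term Σ V
    finiteDomain : Finite (λ x → image x ≢ var x)

open Substitution public using (image)

module _ {Σ : Signature} {V : Set} where

  module _ (σ : Substitution Σ V) where
    mutual
      apply : Term Σ V → Term Σ V
      apply (var x)    = image σ x
      apply (fun f ts) = fun f (applys ts)

      applys : ∀ {n} → Vec (Term Σ V) n → Vec (Term Σ V) n
      applys []       = []
      applys (t ∷ ts) = apply t ∷ applys ts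

  module _ (E : EquationalTheory Σ V) where
    open EquationalTheory E

    infix 4 _≈ᴱ_ _≤ᴱ_ _<ᴱ_

    _≈ᴱ_ : Rel (Term Σ V) (lsuc 0ℓ)
    _≈ᴱ_ = Entails Axiom

    _≤ᴱ_ : Rel (Substitution Σ V) (lsuc 0ℓ)
    σ ≤ᴱ τ = ∃[ l ] (∀ x → apply l (image σ x) ≈ᴱ image τ x)

    _<ᴱ_ : Rel (Substitution Σ V) (lsuc 0ℓ)
    σ <ᴱ τ = σ ≤ᴱ τ × ¬ (τ ≤ᴱ σ)

    IsFinite : Set₁
    IsFinite = ∀ t → Finite (λ s → s ≈ᴱ t)

    IsNoetherian : Set₁
    IsNoetherian = ¬ (∃[ σ ] InfiniteDescendingSequence _<ᴱ_ σ)

{-# OPTIONS --safe #-}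
-- Fix σ₀ with domain contained in the finite list X, and let τ ≤ σ₀ be witnessed
-- by μ.  As E is finite, x ≈ t forces t = x; so τ y is a variable that μ sends
-- back to y for each y ∉ X, and μ (τ x) lies in the finite class of σ₀ x for
-- x ∈ X.  Hence, up to a renaming of the variables not of the form τ y with
-- y ∉ X, only finitely many tuples (τ x)_{x ∈ X} are possible, and this tuple determines τ
-- up to ≤.  By pigeonhole two members of a descending chain would be equivalent.
module Submission where

open import Defs
open import Data.Fin using (toℕ)
open import Data.Fin.Properties using (pigeonhole)
import Data.List as List
open import Data.List
  using (List; []; _∷_; _++_; map; concatMap; cartesianProductWith; length; upTo)
open import Data.List.Membership.Propositional using (_∈_; _∉_; lose)
open import Data.List.Membership.Propositional.Properties
  using (∈-++⁺ˡ; ∈-++⁺ʳ; ∈-++⁻; ∈-map⁺; ∈-concatMap⁺; ∈-cartesianProductWith⁺; ∈-upTo⁺)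
open import Data.List.Properties using (length-++; ∷-injective)
open import Data.List.Relation.Unary.Any using (here; there; index)
open import Data.List.Relation.Unary.Any.Properties using (lookup-index)
open import Data.Nat using (ℕ; zero; suc; _+_; _≤_; _<_; _≤′_; ≤′-refl; ≤′-step; z≤n; s≤s)
open import Data.Nat.ListAction using (sum)
import Data.Nat.Properties as ℕ
open import Data.Product using (∃-syntax; _×_; _,_; proj₁; proj₂)
open import Data.Sum using (_⊎_; inj₁; inj₂)
open import Data.Vec using (Vec; []; _∷_)
open import Data.Vec.Relation.Binary.Pointwise.Inductive using (Pointwise-≡⇒≡)
open import Function using (_∘_; const)
open import Function.Bundles using (_↔_; Inverse)
open import Function.Properties.Inverse using (↔⇒↣)
open import Relation.Binary using (DecidableEquality; Setoid)
open import Relation.Binary.PropositionalEquality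
  using (_≡_; _≢_; refl; sym; trans; cong; cong₂; subst; subst₂; setoid; module ≡-Reasoning)
open import Relation.Nullary using (¬_; Dec; yes; no; contradiction)
open import Relation.Nullary.Decidable using (via-injection; decidable-stable; map′)

-- Finite lists

module _ {A : Set} where

  choices : {B : Set} → (A → List B) → List A → List (List B)
  choices F []       = [] ∷ []
  choices F (x ∷ xs) = cartesianProductWith _∷_ (F x) (choices F xs)

  map-∈-choices : {B : Set} (F : A → List B) (f : A → B) (xs : List A) →
                  (∀ {x} → x ∈ xs → f x ∈ F x) → map f xs ∈ choices F xs
  map-∈-choices F f []       f∈F = here refl
  map-∈-choices F f (x ∷ xs) f∈F =
    ∈-cartesianProductWith⁺ _∷_ (f∈F (here refl)) (map-∈-choices F f xs (f∈F ∘ there))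

  map-≡⇒≡ : {B : Set} {f g : A → B} {xs : List A} →
            map f xs ≡ map g xs → ∀ {x} → x ∈ xs → f x ≡ g x
  map-≡⇒≡ eq (here refl)  = proj₁ (∷-injective eq)
  map-≡⇒≡ eq (there x∈xs) = map-≡⇒≡ (proj₂ (∷-injective eq)) x∈xs

  length-concatMap-≤ : {B : Set} (f : A → List B) (b : A → ℕ) (xs : List A) →
                       (∀ x → length (f x) ≤ b x) → length (concatMap f xs) ≤ sum (map b xs)
  length-concatMap-≤ f b []       f≤b = z≤n
  length-concatMap-≤ f b (x ∷ xs) f≤b rewrite length-++ (f x) {concatMap f xs} =
    ℕ.+-mono-≤ (f≤b x) (length-concatMap-≤ f b xs f≤b)

  ∈⇒≤sum : (f : A → ℕ) {xs : List A} {x : A} → x ∈ xs → f x ≤ sum (map f xs)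
  ∈⇒≤sum f (here refl)              = ℕ.m≤m+n _ _
  ∈⇒≤sum f {y ∷ _} (there x∈xs) = ℕ.≤-trans (∈⇒≤sum f x∈xs) (ℕ.m≤n+m _ (f y))

  -- Pigeonhole is applied to the indices in `xs` of the first `1 + length xs` values; equal indices
  -- give equal values.
  repetition : (s : ℕ → A) (xs : List A) → (∀ n → s n ∈ xs) → ∃[ m ] ∃[ n ] m < n × s m ≡ s n
  repetition s xs s∈xs
    with i , j , i<j , eq ← pigeonhole (ℕ.n<1+n (length xs)) (λ i → index (s∈xs (toℕ i)))
    = toℕ i , toℕ j , i<j ,
      trans (lookup-index (s∈xs (toℕ i)))
        (trans (cong (List.lookup xs) eq) (sym (lookup-index (s∈xs (toℕ j)))))

  -- Junk value d beyond the end of the list.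
  nth : A → List A → ℕ → A
  nth d []       _       = d
  nth d (x ∷ xs) zero    = x
  nth d (x ∷ xs) (suc n) = nth d xs n

  module _ (_≟_ : DecidableEquality A) where

    -- Junk value (the length of the list) for non-members.
    position : A → List A → ℕ
    position a [] = zero
    position a (x ∷ xs) with a ≟ x
    ... | yes _ = zero
    ... | no  _ = suc (position a xs)

    position-< : ∀ {a xs} → a ∈ xs → position a xs < length xs
    position-< {a} {x ∷ xs} a∈ with a ≟ x | a∈
    ... | yes _  | _          = s≤s z≤n
    ... | no a≢x | here a≡x   = contradiction a≡x a≢x
    ... | no _   | there a∈xs = s≤s (position-< a∈xs)

    nth-position : ∀ {d a xs} → a ∈ xs → nth d xs (position a xs) ≡ a
    nth-position {d} {a} {x ∷ xs} a∈ with a ≟ x | a∈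
    ... | yes a≡x | _          = sym a≡x
    ... | no a≢x  | here a≡x   = contradiction a≡x a≢x
    ... | no _    | there a∈xs = nth-position a∈xs

-- Terms

module _ {Σ : Signature} {V : Set} where

  mutual
    vars : Term Σ V → List V
    vars (var x)    = x ∷ []
    vars (fun f ts) = varss ts

    varss : ∀ {n} → Vec (Term Σ V) n → List V
    varss []       = []
    varss (t ∷ ts) = vars t ++ varss ts

  mutual
    size : Term Σ V → ℕ
    size (var x)    = 1
    size (fun f ts) = suc (sizes ts)

    sizes : ∀ {n} → Vec (Term Σ V) n → ℕ
    sizes []       = 0
    sizes (t ∷ ts) = size t + sizes ts

  1≤size : (t : Term Σ V) → 1 ≤ size t
  1≤size (var x)    = s≤s z≤n
  1≤size (fun f ts) = s≤s z≤n

  module _ (𝓐 : Algebra Σ) {ρ ρ′ : V → Algebra.Carrier 𝓐} where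
    mutual
      eval-local : ∀ t → (∀ {v} → v ∈ vars t → ρ v ≡ ρ′ v) → eval 𝓐 ρ t ≡ eval 𝓐 ρ′ t
      eval-local (var x)    eq = eq (here refl)
      eval-local (fun f ts) eq = cong (Algebra.op 𝓐 f) (evals-local ts eq)

      evals-local : ∀ {n} (ts : Vec (Term Σ V) n) → (∀ {v} → v ∈ varss ts → ρ v ≡ ρ′ v) →
                    evals 𝓐 ρ ts ≡ evals 𝓐 ρ′ ts
      evals-local []       eq = refl
      evals-local (t ∷ ts) eq =
        cong₂ _∷_ (eval-local t (eq ∘ ∈-++⁺ˡ)) (evals-local ts (eq ∘ ∈-++⁺ʳ (vars t)))

-- Substitution as evaluation in the term algebra.

termAlgebra : (Σ : Signature) → Set → Algebra Σ
termAlgebra Σ W = record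
  { setoid  = setoid (Term Σ W)
  ; op      = fun
  ; op-cong = λ f as≡bs → cong (fun f) (Pointwise-≡⇒≡ as≡bs)
  }

module _ {Σ : Signature} {V W : Set} where

  -- Unlike `apply`, this accepts any map and may change the variable set, as the encoding into
  -- `V ⊎ ℕ` requires.
  bind : (V → Term Σ W) → Term Σ V → Term Σ W
  bind g = eval (termAlgebra Σ W) g

  binds : ∀ {n} → (V → Term Σ W) → Vec (Term Σ V) n → Vec (Term Σ W) n
  binds g = evals (termAlgebra Σ W) g

  module _ (𝓐 : Algebra Σ) (ρ : W → Algebra.Carrier 𝓐) (g : V → Term Σ W) where
    mutual
      -- The substitution lemma. In the term algebra it says how substitutions compose; in models it
      -- makes `≈` stable under `bind`.
      eval-bind : ∀ t → eval 𝓐 ρ (bind g t) ≡ eval 𝓐 (eval 𝓐 ρ ∘ g) t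
      eval-bind (var x)    = refl
      eval-bind (fun f ts) = cong (Algebra.op 𝓐 f) (evals-binds ts)

      evals-binds : ∀ {n} (ts : Vec (Term Σ V) n) →
                    evals 𝓐 ρ (binds g ts) ≡ evals 𝓐 (eval 𝓐 ρ ∘ g) ts
      evals-binds []       = refl
      evals-binds (t ∷ ts) = cong₂ _∷_ (eval-bind t) (evals-binds ts)

  module _ (g : V → Term Σ W) where
    mutual
      ∈-vars-bind : ∀ t {v w} → v ∈ vars t → w ∈ vars (g v) → w ∈ vars (bind g t)
      ∈-vars-bind (var x)    (here refl) w∈ = w∈
      ∈-vars-bind (fun f ts) v∈          w∈ = ∈-varss-binds ts v∈ w∈

      ∈-varss-binds : ∀ {n} (ts : Vec (Term Σ V) n) {v w} →
                      v ∈ varss ts → w ∈ vars (g v) → w ∈ varss (binds g ts)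
      ∈-varss-binds (t ∷ ts) v∈ w∈ with ∈-++⁻ (vars t) v∈
      ... | inj₁ v∈t  = ∈-++⁺ˡ (∈-vars-bind t v∈t w∈)
      ... | inj₂ v∈ts = ∈-++⁺ʳ (vars (bind g t)) (∈-varss-binds ts v∈ts w∈)

    mutual
      size-bind : ∀ t {v} → v ∈ vars t → size (g v) ≤ size (bind g t)
      size-bind (var x)    (here refl) = ℕ.≤-refl
      size-bind (fun f ts) v∈          = ℕ.m≤n⇒m≤1+n (sizes-binds ts v∈)

      sizes-binds : ∀ {n} (ts : Vec (Term Σ V) n) {v} → v ∈ varss ts →
                    size (g v) ≤ sizes (binds g ts)
      sizes-binds (t ∷ ts) v∈ with ∈-++⁻ (vars t) v∈
      ... | inj₁ v∈t  = ℕ.≤-trans (size-bind t v∈t) (ℕ.m≤m+n _ _)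
      ... | inj₂ v∈ts = ℕ.≤-trans (sizes-binds ts v∈ts) (ℕ.m≤n+m _ (size (bind g t)))

    mutual
      -- Each variable occurrence of `t` becomes a subterm of size at least 1.
      length-vars-≤ : ∀ t → length (vars t) ≤ size (bind g t)
      length-vars-≤ (var x)    = 1≤size (g x)
      length-vars-≤ (fun f ts) = ℕ.m≤n⇒m≤1+n (length-varss-≤ ts)

      length-varss-≤ : ∀ {n} (ts : Vec (Term Σ V) n) → length (varss ts) ≤ sizes (binds g ts)
      length-varss-≤ []       = z≤n
      length-varss-≤ (t ∷ ts) rewrite length-++ (vars t) {varss ts} =
        ℕ.+-mono-≤ (length-vars-≤ t) (length-varss-≤ ts)

module _ {Σ : Signature} {V : Set} where

  mutual
    bind-var : (t : Term Σ V) → bind var t ≡ t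
    bind-var (var x)    = refl
    bind-var (fun f ts) = cong (fun f) (binds-var ts)

    binds-var : ∀ {n} (ts : Vec (Term Σ V) n) → binds var ts ≡ ts
    binds-var []       = refl
    binds-var (t ∷ ts) = cong₂ _∷_ (bind-var t) (binds-var ts)

  module _ (l : Substitution Σ V) where
    mutual
      apply≡bind : ∀ t → apply l t ≡ bind (image l) t
      apply≡bind (var x)    = refl
      apply≡bind (fun f ts) = cong (fun f) (applys≡binds ts)

      applys≡binds : ∀ {n} (ts : Vec (Term Σ V) n) → applys l ts ≡ binds (image l) ts
      applys≡binds []       = refl
      applys≡binds (t ∷ ts) = cong₂ _∷_ (apply≡bind t) (applys≡binds ts)

-- Generalizations of a term.

module _ {Σ : Signature} {V W : Set} (ws : List W) where
  mutual
    -- Every way of cutting off subterms and putting variables from `ws` in their place. One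
    -- variable may replace different subterms, so some entries do not have the given term as an
    -- instance.
    generalizations : Term Σ V → List (Term Σ W)
    generalizations (var x)    = map var ws
    generalizations (fun f ts) = map var ws ++ map (fun f) (generalizationss ts)

    generalizationss : ∀ {n} → Vec (Term Σ V) n → List (Vec (Term Σ W) n)
    generalizationss []       = [] ∷ []
    generalizationss (t ∷ ts) =
      cartesianProductWith _∷_ (generalizations t) (generalizationss ts)

  var-∈-generalizations : ∀ t {w} → w ∈ ws → var w ∈ generalizations t
  var-∈-generalizations (var x)    w∈ = ∈-map⁺ var w∈
  var-∈-generalizations (fun f ts) w∈ = ∈-++⁺ˡ (∈-map⁺ var w∈)

  module _ {U : Set} (g : U → Term Σ V) (c : U → W) where
    mutual
      -- Cut `bind g s` at the variable positions of `s` and insert there the values of `c`.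
      rename-∈-generalizations :
        ∀ s → (∀ {u} → u ∈ vars s → c u ∈ ws) → bind (var ∘ c) s ∈ generalizations (bind g s)
      rename-∈-generalizations (var u)    c∈ = var-∈-generalizations (g u) (c∈ (here refl))
      rename-∈-generalizations (fun f ss) c∈ =
        ∈-++⁺ʳ (map var ws) (∈-map⁺ (fun f) (renames-∈-generalizationss ss c∈))

      renames-∈-generalizationss :
        ∀ {n} (ss : Vec (Term Σ U) n) → (∀ {u} → u ∈ varss ss → c u ∈ ws) →
        binds (var ∘ c) ss ∈ generalizationss (binds g ss)
      renames-∈-generalizationss []       c∈ = here refl
      renames-∈-generalizationss (s ∷ ss) c∈ =
        ∈-cartesianProductWith⁺ _∷_ (rename-∈-generalizations s (c∈ ∘ ∈-++⁺ˡ))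
          (renames-∈-generalizationss ss (c∈ ∘ ∈-++⁺ʳ (vars s)))

-- The instantiation preorder

module _ {Σ : Signature} {V : Set} (_≟_ : DecidableEquality V) where

  open import Data.List.Membership.DecPropositional _≟_ using (_∈?_)

  isVar? : (t : Term Σ V) (v : V) → Dec (t ≡ var v)
  isVar? (var x)    v = map′ (cong var) (λ { refl → refl }) (x ≟ v)
  isVar? (fun f ts) v = no λ ()

  domain : Substitution Σ V → List V
  domain σ = proj₁ (finiteDomain σ)
    where open Substitution

  -- `finiteDomain` gives only a double negation; it is removed because being a given variable is
  -- decidable.
  outside-domain : ∀ σ {x} → x ∉ domain σ → image σ x ≡ var x
  outside-domain σ {x} x∉ =
    decidable-stable (isVar? (image σ x) x) (x∉ ∘ proj₂ (Substitution.finiteDomain σ) x)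

  substitution : (g : V → Term Σ V) (xs : List V) → (∀ {x} → x ∉ xs → g x ≡ var x) →
                 Substitution Σ V
  substitution g xs fixed = record { image = g ; finiteDomain = xs , support }
    where
    support : ∀ x → g x ≢ var x → x ∈ xs
    support x gx≢x = decidable-stable (x ∈? xs) (gx≢x ∘ fixed)

  compose : Substitution Σ V → Substitution Σ V → Substitution Σ V
  compose l k = substitution (bind (image l) ∘ image k) (domain k ++ domain l) fixed
    where
    fixed : ∀ {x} → x ∉ domain k ++ domain l → bind (image l) (image k x) ≡ var x
    fixed x∉ = trans (cong (bind (image l)) (outside-domain k (x∉ ∘ ∈-++⁺ˡ)))
                     (outside-domain l (x∉ ∘ ∈-++⁺ʳ (domain k)))

  apply-compose : ∀ l k t → apply (compose l k) t ≡ apply l (apply k t)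
  apply-compose l k t = begin
    apply (compose l k) t                ≡⟨ apply≡bind (compose l k) t ⟩
    bind (bind (image l) ∘ image k) t    ≡⟨ eval-bind (termAlgebra Σ V) (image l) (image k) t ⟨
    bind (image l) (bind (image k) t)    ≡⟨ cong (bind (image l)) (apply≡bind k t) ⟨
    bind (image l) (apply k t)           ≡⟨ apply≡bind l (apply k t) ⟨
    apply l (apply k t)                  ∎
    where open ≡-Reasoning

  module _ (E : EquationalTheory Σ V) where

    open EquationalTheory E

    -- Records, so that the related terms and substitutions can be inferred from a proof.
    infix 4 _≈_ _≲_

    record _≈_ (s t : Term Σ V) : Set₁ where
      constructor entailed
      field entails : Entails Axiom s t

    open _≈_

    record _≲_ (σ τ : Substitution Σ V) : Set₁ where
      constructor via
      field
        instantiator : Substitution Σ V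
        instantiates : ∀ x → apply instantiator (image σ x) ≈ image τ x

    open _≲_

    ≤ᴱ⇒≲ : ∀ {σ τ} → _≤ᴱ_ E σ τ → σ ≲ τ
    ≤ᴱ⇒≲ (l , lσ≈τ) = via l (entailed ∘ lσ≈τ)

    ≲⇒≤ᴱ : ∀ {σ τ} → σ ≲ τ → _≤ᴱ_ E σ τ
    ≲⇒≤ᴱ (via l lσ≈τ) = l , entails ∘ lσ≈τ

    ≈-reflexive : ∀ {s t} → s ≡ t → s ≈ t
    ≈-reflexive refl = entailed λ 𝓐 _ ρ → Setoid.refl (Algebra.setoid 𝓐)

    ≈-sym : ∀ {s t} → s ≈ t → t ≈ s
    ≈-sym (entailed s≈t) = entailed λ 𝓐 mod ρ → Setoid.sym (Algebra.setoid 𝓐) (s≈t 𝓐 mod ρ)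

    ≈-trans : ∀ {s t u} → s ≈ t → t ≈ u → s ≈ u
    ≈-trans (entailed s≈t) (entailed t≈u) =
      entailed λ 𝓐 mod ρ → Setoid.trans (Algebra.setoid 𝓐) (s≈t 𝓐 mod ρ) (t≈u 𝓐 mod ρ)

    ≈-bind : ∀ g {s t} → s ≈ t → bind g s ≈ bind g t
    ≈-bind g {s} {t} (entailed s≈t) = entailed λ 𝓐 mod ρ →
      subst₂ (Algebra._≈_ 𝓐) (sym (eval-bind 𝓐 ρ g s)) (sym (eval-bind 𝓐 ρ g t))
        (s≈t 𝓐 mod (eval 𝓐 ρ ∘ g))

    ≈-apply : ∀ l {s t} → s ≈ t → apply l s ≈ apply l t
    ≈-apply l {s} {t} s≈t =
      subst₂ _≈_ (sym (apply≡bind l s)) (sym (apply≡bind l t)) (≈-bind (image l) s≈t)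

    ≲-refl : ∀ {σ} → σ ≲ σ
    ≲-refl {σ} = via (substitution var [] (λ _ → refl)) λ x →
      ≈-reflexive (trans (apply≡bind _ (image σ x)) (bind-var (image σ x)))

    ≲-trans : ∀ {σ τ υ} → σ ≲ τ → τ ≲ υ → σ ≲ υ
    ≲-trans {σ} (via k kσ≈τ) (via l lτ≈υ) = via (compose l k) λ x →
      ≈-trans (≈-reflexive (apply-compose l k (image σ x)))
        (≈-trans (≈-apply l (kσ≈τ x)) (lτ≈υ x))

    -- Classes of variables in a finite theory.

    module _ (v₀ : V) (fresh : (x : V) → ∃[ y ] x ≢ y) (finite : IsFinite E) where

      class : Term Σ V → List (Term Σ V)
      class t = proj₁ (finite t)

      ≈⇒∈class : ∀ {s t} → s ≈ t → s ∈ class t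
      ≈⇒∈class {s} {t} (entailed s≈t) = proj₂ (finite t) s s≈t

      -- Otherwise iterating s ↦ t[s, …, s] from var x produces arbitrarily large
      -- terms equal to var x (t has a variable, by non-triviality).
      fun≉var : ∀ {f ts x} → ¬ (fun f ts ≈ var x)
      fun≉var {f} {ts} {x} t≈x with varss ts in eq
      -- A ground term is fixed by every substitution, so it would equal a second variable as well.
      ... | [] = nonTrivial (proj₂ (fresh x)) (entails
                   (≈-trans (≈-sym t≈x) (≈-trans t≈bind (≈-bind (const y) t≈x))))
        where
        y = var (proj₁ (fresh x))
        no-vars : ∀ {v} → v ∉ varss ts
        no-vars v∈ with () ← subst (_ ∈_) eq v∈
        t≈bind : fun f ts ≈ bind (const y) (fun f ts)
        t≈bind = ≈-reflexive (trans (sym (bind-var (fun f ts)))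
          (eval-local (termAlgebra Σ V) (fun f ts) (λ v∈ → contradiction v∈ no-vars)))
      ... | v ∷ _ = ℕ.<-irrefl refl (ℕ.≤-trans large (∈⇒≤sum size (≈⇒∈class s≈x)))
        where
        arbitrarily-large : ∀ n → ∃[ s ] n ≤ size s × s ≈ var x
        arbitrarily-large zero    = var x , z≤n , ≈-reflexive refl
        arbitrarily-large (suc n) with s , n≤ , s≈x ← arbitrarily-large n =
          bind (const s) (fun f ts) ,
          -- As `v` occurs in `ts`, a copy of `s` lies strictly below `f`, which adds one to the
          -- size.
          s≤s (ℕ.≤-trans n≤ (sizes-binds (const s) ts (subst (v ∈_) (sym eq) (here refl)))) ,
          ≈-trans (≈-bind (const s) t≈x) s≈x
        -- The sum of the sizes bounds the size of each member of the class, and this term exceeds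
        -- it.
        too-large = arbitrarily-large (suc (sum (map size (class (var x)))))
        large     = proj₁ (proj₂ too-large)
        s≈x       = proj₂ (proj₂ too-large)

      ≈var⇒≡ : ∀ t {x} → t ≈ var x → t ≡ var x
      ≈var⇒≡ (var y)    {x} y≈x =
        cong var (decidable-stable (y ≟ x) (λ y≢x → nonTrivial y≢x (entails y≈x)))
      ≈var⇒≡ (fun f ts) t≈x = contradiction t≈x fun≉var

      -- Finitely many patterns below a fixed substitution.

      module _ (σ₀ : Substitution Σ V) where

        private
          X : List V
          X = domain σ₀

        classAt : V → List (Term Σ V)
        classAt x = class (image σ₀ x)

        -- Computed from `σ₀` alone, so that one finite list serves all `τ` below it: the variables
        -- in the classes of its images on `X`, and numbers below a bound on the variable
        -- occurrences in the tuple.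
        codes : List (V ⊎ ℕ)
        codes = map inj₁ (concatMap (concatMap vars ∘ classAt) X)
             ++ map inj₂ (upTo (sum (map (sum ∘ map size ∘ classAt) X)))

        patterns : List (List (Term Σ (V ⊎ ℕ)))
        patterns = choices (concatMap (generalizations codes) ∘ classAt) X

        module _ {τ : Substitution Σ V} (τ≲σ₀ : τ ≲ σ₀) where

          private
            μ : Substitution Σ V
            μ = instantiator τ≲σ₀

          tupleVars : List V
          tupleVars = concatMap (vars ∘ image τ) X

          -- inj₁ y stands for the variable τ y; the other variables are
          -- numbered by their first occurrence in the tuple (τ x)_{x ∈ X}.
          encode : V → V ⊎ ℕ
          encode v with image μ v
          ... | fun _ _ = inj₂ (position _≟_ v tupleVars)
          ... | var y with isVar? (image τ y) v
          ...   | yes _ = inj₁ y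
          ...   | no  _ = inj₂ (position _≟_ v tupleVars)

          decode : V ⊎ ℕ → Term Σ V
          decode (inj₁ y) = image τ y
          decode (inj₂ i) = var (nth v₀ tupleVars i)

          pattern-of : List (Term Σ (V ⊎ ℕ))
          pattern-of = map (bind (var ∘ encode) ∘ image τ) X

          -- The test in `encode` guarantees this for codes `inj₁ y`; for numbers, membership in
          -- `tupleVars` rules out the junk values.
          decode-encode : ∀ {v} → v ∈ tupleVars → decode (encode v) ≡ var v
          decode-encode {v} v∈ with image μ v
          ... | fun _ _ = cong var (nth-position _≟_ v∈)
          ... | var y with isVar? (image τ y) v
          ...   | yes τy≡v = τy≡v
          ...   | no  _    = cong var (nth-position _≟_ v∈)

          encode≡inj₁ : ∀ {v y} → image μ v ≡ var y → image τ y ≡ var v → encode v ≡ inj₁ y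
          encode≡inj₁ {v} {y} μv≡y τy≡v with image μ v | μv≡y
          ... | var .y | refl with isVar? (image τ y) v
          ...   | yes _    = refl
          ...   | no τy≢v = contradiction τy≡v τy≢v

          instance-∈-class : ∀ x → bind (image μ) (image τ x) ∈ classAt x
          instance-∈-class x = ≈⇒∈class
            (subst (_≈ image σ₀ x) (apply≡bind μ (image τ x)) (instantiates τ≲σ₀ x))

          -- Here μ (τ y) ≈ y, hence both are syntactically equal, and only a variable has a
          -- variable as an instance.
          renaming-outside : ∀ {y} → y ∉ X → ∃[ v ] image τ y ≡ var v × image μ v ≡ var y
          renaming-outside {y} y∉X
            with image τ y
               | ≈var⇒≡ (apply μ (image τ y))
                   (subst (apply μ (image τ y) ≈_) (outside-domain σ₀ y∉X) (instantiates τ≲σ₀ y))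
          ... | var v | μv≡y = v , refl , μv≡y

          position-∈-codes : ∀ {v} → v ∈ tupleVars → inj₂ (position _≟_ v tupleVars) ∈ codes
          position-∈-codes v∈ = ∈-++⁺ʳ _ (∈-map⁺ inj₂ (∈-upTo⁺
            (ℕ.<-≤-trans (position-< _≟_ v∈) (length-concatMap-≤ _ _ X length-vars-≤-sum))))
            where
            length-vars-≤-sum : ∀ x → length (vars (image τ x)) ≤ sum (map size (classAt x))
            length-vars-≤-sum x = ℕ.≤-trans (length-vars-≤ (image μ) (image τ x))
                                            (∈⇒≤sum size (instance-∈-class x))

          -- If `v` occurs in τ x and μ v = y, then `y` occurs in μ (τ x), a member of the class of
          -- σ₀ x. Numbered variables fall under the size bound.
          encode-∈-codes : ∀ {x v} → x ∈ X → v ∈ vars (image τ x) → encode v ∈ codes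
          encode-∈-codes {x} {v} x∈X v∈ with image μ v in μv≡
          ... | fun _ _ = position-∈-codes (∈-concatMap⁺ _ (lose x∈X v∈))
          ... | var y with isVar? (image τ y) v
          ...   | no  _ = position-∈-codes (∈-concatMap⁺ _ (lose x∈X v∈))
          ...   | yes _ = ∈-++⁺ˡ (∈-map⁺ inj₁ (∈-concatMap⁺ _ (lose x∈X
                    (∈-concatMap⁺ vars (lose (instance-∈-class x) y∈)))))
            where
            y∈ : y ∈ vars (bind (image μ) (image τ x))
            y∈ = ∈-vars-bind (image μ) (image τ x) v∈
                   (subst (λ t → y ∈ vars t) (sym μv≡) (here refl))

          pattern-∈-patterns : pattern-of ∈ patterns
          pattern-∈-patterns = map-∈-choices _ _ X λ {x} x∈X →
            ∈-concatMap⁺ (generalizations codes) (lose (instance-∈-class x)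
              (rename-∈-generalizations codes (image μ) encode (image τ x) (encode-∈-codes x∈X)))

        -- Comparing substitutions with equal patterns.

        module _ {τ τ′ : Substitution Σ V} (τ≲σ₀ : τ ≲ σ₀) (τ′≲σ₀ : τ′ ≲ σ₀) where

          -- The candidate instantiator from `τ` to `τ′`: a code computed relative to `τ` is read
          -- relative to `τ′`.
          transfer : V → Term Σ V
          transfer = decode τ′≲σ₀ ∘ encode τ≲σ₀

          -- Since μ v = y, the code of `v` is `inj₁ y`, which decodes to τ′ y.
          transfer-outside : ∀ {y v} → y ∉ X → image τ y ≡ var v → transfer v ≡ image τ′ y
          transfer-outside {y} {v} y∉X τy≡v with w , τy≡w , μw≡y ← renaming-outside τ≲σ₀ y∉X
            with refl ← trans (sym τy≡v) τy≡w
            = cong (decode τ′≲σ₀) (encode≡inj₁ τ≲σ₀ μw≡y τy≡v)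

          -- Encoding τ x gives the same term as encoding τ′ x, and decoding the latter relative to
          -- `τ′` restores τ′ x.
          transfer-inside : pattern-of τ≲σ₀ ≡ pattern-of τ′≲σ₀ →
                            ∀ {x} → x ∈ X → bind transfer (image τ x) ≡ image τ′ x
          transfer-inside eq {x} x∈X = begin
            bind transfer (image τ x)
              ≡⟨ eval-bind (termAlgebra Σ V) d (var ∘ c) (image τ x) ⟨
            bind d (bind (var ∘ c) (image τ x))
              ≡⟨ cong (bind d) (map-≡⇒≡ eq x∈X) ⟩
            bind d (bind (var ∘ c′) (image τ′ x))
              ≡⟨ eval-bind (termAlgebra Σ V) d (var ∘ c′) (image τ′ x) ⟩
            bind (d ∘ c′) (image τ′ x)
              ≡⟨ eval-local (termAlgebra Σ V) (image τ′ x)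
                   (λ v∈ → decode-encode τ′≲σ₀ (∈-concatMap⁺ _ (lose x∈X v∈))) ⟩
            bind var (image τ′ x)
              ≡⟨ bind-var (image τ′ x) ⟩
            image τ′ x ∎
            where
            open ≡-Reasoning
            c  = encode τ≲σ₀
            c′ = encode τ′≲σ₀
            d  = decode τ′≲σ₀

          pattern≡⇒≲ : pattern-of τ≲σ₀ ≡ pattern-of τ′≲σ₀ → τ ≲ τ′
          pattern≡⇒≲ eq = via l λ x → ≈-reflexive (trans (apply≡bind l (image τ x)) (transfer-image x))
            where
            -- Away from `X` and both domains, v = τ v is sent to τ′ v = v, so `transfer` has finite
            -- domain.
            fixed : ∀ {v} → v ∉ X ++ domain τ ++ domain τ′ → transfer v ≡ var v
            fixed v∉ = trans
              (transfer-outside (v∉ ∘ ∈-++⁺ˡ) (outside-domain τ (v∉ ∘ ∈-++⁺ʳ X ∘ ∈-++⁺ˡ)))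
              (outside-domain τ′ (v∉ ∘ ∈-++⁺ʳ X ∘ ∈-++⁺ʳ (domain τ)))

            l : Substitution Σ V
            l = substitution transfer (X ++ domain τ ++ domain τ′) fixed

            transfer-image : ∀ x → bind transfer (image τ x) ≡ image τ′ x
            transfer-image x with x ∈? X
            ... | yes x∈X = transfer-inside eq x∈X
            ... | no  x∉X with v , τx≡v , _ ← renaming-outside τ≲σ₀ x∉X =
              trans (cong (bind transfer) τx≡v) (transfer-outside x∉X τx≡v)

      -- Descending chains.

      noetherian : IsNoetherian E
      -- With m < n, σ m ≲ σ n ≲ σ (m + 1) contradicts the strict descent at `m`.
      noetherian (σ , descends) = proj₂ (descends m) (≲⇒≤ᴱ (≲-trans σₘ≲σₙ (antitone m<n)))
        where
        antitone′ : ∀ {m n} → m ≤′ n → σ n ≲ σ m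
        antitone′ ≤′-refl                = ≲-refl
        antitone′ {n = suc n} (≤′-step m≤n) = ≲-trans (≤ᴱ⇒≲ (proj₁ (descends n))) (antitone′ m≤n)

        antitone : ∀ {m n} → m ≤ n → σ n ≲ σ m
        antitone = antitone′ ∘ ℕ.≤⇒≤′

        below : ∀ n → σ n ≲ σ 0
        below n = antitone z≤n

        repeated = repetition (λ n → pattern-of (σ 0) (below n)) (patterns (σ 0))
                     (λ n → pattern-∈-patterns (σ 0) (below n))

        m = proj₁ repeated
        n = proj₁ (proj₂ repeated)
        m<n = proj₁ (proj₂ (proj₂ repeated))

        σₘ≲σₙ : σ m ≲ σ n
        σₘ≲σₙ = pattern≡⇒≲ (σ 0) (below m) (below n) (proj₂ (proj₂ (proj₂ repeated)))

lemma6p8 : (Σ : Signature) (V : Set) → V ↔ ℕ →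
    (E : EquationalTheory Σ V) → IsFinite E → IsNoetherian E
-- The bijection with ℕ supplies decidable equality, the junk variable `from 0`, and a second
-- variable for each `x` through the successor of its index.
lemma6p8 Σ V V↔ℕ E finite = noetherian (via-injection (↔⇒↣ V↔ℕ) ℕ._≟_) E (from 0) fresh finite
  where
  open Inverse V↔ℕ using (to; from; strictlyInverseˡ)
  fresh : (x : V) → ∃[ y ] x ≢ y
  fresh x = from (suc (to x)) , λ x≡y →
    ℕ.1+n≢n (sym (trans (cong to x≡y) (strictlyInverseˡ (suc (to x)))))
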